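{- The following estimates hold: $$g_{\mathrm{ord}}(d,q)\ \ge\ \omega^{|\Sigma_{d-1}(q-4)|}\qquad\text{for all } d\ge2,\ q\ge5,$$ $$g_{\mathrm{ord}}(d,q)\ \ge\ \omega^{|\Sigma_{2}(q-7)|}\qquad\text{for all } d\ge2,\ q\ge8.$$
   Context: For $d\ge1$, a $d$-colored ordinal is a structure $\mathfrak A=(A,<,C_0,\dots,C_{d-1})$ where $(A,<)$ is an ordinal (well-order) and the unary predicates $C_i$ partition $A$; empty domains and empty color classes are allowed. $\operatorname{otp}(A)$ is the order type of $(A,<)$. $\equiv_q$ means agreement on all first-order sentences of quantifier rank at most $q$. $\Sigma_d(q)$ is a (finite) set containing exactly one $q$-characteristic sentence for each $\equiv_q$-class of $d$-colored ordinals, i.e. a sentence of quantifier rank at most $q$ whose $d$-colored ordinal models are exactly the members of that class; so $|\Sigma_d(q)|$ is the number of $\equiv_q$-classes of $d$-colored ordinals. Define $$g_{\mathrm{ord}}(d,q)=\max_{\sigma\in\Sigma_d(q)}\min\{\operatorname{otp}(A):\mathfrak A \text{ a } d\text{ -colored ordinal},\ \mathfrak A\models\sigma\}.$$ -}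

module Defs where

open import Data.Empty using (⊥)
open import Data.Fin using (Fin)
import Data.Fin as Fin
import Data.Fin.Induction as Fin
import Data.Fin.Properties as Fin
open import Data.Nat using (ℕ; zero; suc; _≤_; _⊔_)
import Data.Nat as ℕ
import Data.Nat.Induction as ℕ
import Data.Nat.Properties as ℕ
open import Data.Product using (Σ; ∃; ∃-syntax; _×_; _,_)
open import Data.Product.Relation.Binary.Lex.Strict
  using (×-Lex; ×-isStrictTotalOrder; ×-wellFounded)
open import Data.Product.Relation.Binary.Pointwise.NonDependent using (≡×≡⇒≡; ≡⇒≡×≡)
open import Data.Sum using (_⊎_)
open import Data.Vec using (Vec; []; _∷_; lookup)
open import Function using (_∘_; _⇔_)
open import Induction.WellFounded using (WellFounded)
open import Level using (0ℓ)
open import Relation.Binary.Core using (Rel)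
open import Relation.Binary.Definitions using (Trichotomous; Tri; tri<; tri≈; tri>)
open import Relation.Binary.Morphism.Structures using (IsOrderMonomorphism; IsOrderIsomorphism)
open import Relation.Binary.PropositionalEquality using (_≡_; isEquivalence; resp₂)
open import Relation.Binary.Structures using (IsStrictTotalOrder)
open import Relation.Nullary using (¬_)

-- Order types are represented by well-orders, compared by _≅ᵒ_ and _≤ᵒ_.
record WellOrder : Set₁ where
  infix 4 _<_
  field
    Carrier            : Set
    _<_                : Rel Carrier 0ℓ
    isStrictTotalOrder : IsStrictTotalOrder _≡_ _<_
    wellFounded        : WellFounded _<_

infix 4 _≅ᵒ_ _≤ᵒ_

_≅ᵒ_ : WellOrder → WellOrder → Set
α ≅ᵒ β = Σ (α.Carrier → β.Carrier) (IsOrderIsomorphism _≡_ _≡_ α._<_ β._<_)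
  where
  module α = WellOrder α
  module β = WellOrder β

-- α is isomorphic to an initial segment of β.
_≤ᵒ_ : WellOrder → WellOrder → Set
α ≤ᵒ β =
  Σ (α.Carrier → β.Carrier) λ f →
    IsOrderMonomorphism _≡_ _≡_ α._<_ β._<_ f ×
    (∀ a b → b β.< f a → ∃[ a′ ] f a′ ≡ b)
  where
  module α = WellOrder α
  module β = WellOrder β

fin : ℕ → WellOrder
fin n = record
  { Carrier            = Fin n
  ; _<_                = Fin._<_
  ; isStrictTotalOrder = Fin.<-isStrictTotalOrder
  ; wellFounded        = Fin.<-wellFounded
  }

ω : WellOrder
ω = record
  { Carrier            = ℕ
  ; _<_                = ℕ._<_
  ; isStrictTotalOrder = ℕ.<-isStrictTotalOrder
  ; wellFounded        = ℕ.<-wellFounded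
  }

infixl 7 _·_

-- β copies of α: the β-component is the more significant one.
_·_ : WellOrder → WellOrder → WellOrder
α · β = record
  { Carrier            = β.Carrier × α.Carrier
  ; _<_                = _<ₗₑₓ_
  ; isStrictTotalOrder = record
    { isStrictPartialOrder = record
      { isEquivalence = isEquivalence
      ; irrefl        = Lex.irrefl ∘ ≡⇒≡×≡
      ; trans         = Lex.trans
      ; <-resp-≈      = resp₂ _<ₗₑₓ_
      }
    ; compare = compare
    }
  ; wellFounded        = ×-wellFounded β.wellFounded α.wellFounded
  }
  where
  module α = WellOrder α
  module β = WellOrder β
  _<ₗₑₓ_ : Rel (β.Carrier × α.Carrier) 0ℓ
  _<ₗₑₓ_ = ×-Lex _≡_ β._<_ α._<_
  module Lex = IsStrictTotalOrder
    (×-isStrictTotalOrder β.isStrictTotalOrder α.isStrictTotalOrder)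
  compare : Trichotomous _≡_ _<ₗₑₓ_
  compare x y with Lex.compare x y
  ... | tri< a b c = tri< a (b ∘ ≡⇒≡×≡) c
  ... | tri≈ a b c = tri≈ a (≡×≡⇒≡ b) c
  ... | tri> a b c = tri> a (b ∘ ≡⇒≡×≡) c

infix 8 ω^_

ω^_ : ℕ → WellOrder
ω^ zero  = fin 1
ω^ suc n = ω^ n · ω

-- The partition C₀, …, C_{d-1} is given by the map sending a point to the
-- index of its class.
record ColoredOrdinal (d : ℕ) : Set₁ where
  field
    otp   : WellOrder
    color : WellOrder.Carrier otp → Fin d

  open WellOrder otp public

open ColoredOrdinal using (otp)

infix  9 _≐_ _≺_
infixr 7 _∧̇_
infixr 6 _∨̇_
infixr 5 _⇒̇_

-- First-order formulas with free variables among n de Bruijn indices.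
data Formula (d : ℕ) : ℕ → Set where
  _≐_ _≺_        : ∀ {n} → Fin n → Fin n → Formula d n
  C              : ∀ {n} → Fin d → Fin n → Formula d n
  ⊥̇              : ∀ {n} → Formula d n
  _∧̇_ _∨̇_ _⇒̇_    : ∀ {n} → Formula d n → Formula d n → Formula d n
  ∃̇_ ∀̇_          : ∀ {n} → Formula d (suc n) → Formula d n

Sentence : ℕ → Set
Sentence d = Formula d 0

qr : ∀ {d n} → Formula d n → ℕ
qr (x ≐ y) = 0
qr (x ≺ y) = 0
qr (C i x) = 0
qr ⊥̇       = 0
qr (φ ∧̇ ψ) = qr φ ⊔ qr ψ
qr (φ ∨̇ ψ) = qr φ ⊔ qr ψ
qr (φ ⇒̇ ψ) = qr φ ⊔ qr ψ
qr (∃̇ φ)   = suc (qr φ)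
qr (∀̇ φ)   = suc (qr φ)

module _ {d : ℕ} (𝔄 : ColoredOrdinal d) where
  open ColoredOrdinal 𝔄 using (Carrier; _<_; color)

  ⟦_⟧ : ∀ {n} → Formula d n → Vec Carrier n → Set
  ⟦ x ≐ y ⟧ ρ = lookup ρ x ≡ lookup ρ y
  ⟦ x ≺ y ⟧ ρ = lookup ρ x < lookup ρ y
  ⟦ C i x ⟧ ρ = color (lookup ρ x) ≡ i
  ⟦ ⊥̇ ⟧     ρ = ⊥
  ⟦ φ ∧̇ ψ ⟧ ρ = ⟦ φ ⟧ ρ × ⟦ ψ ⟧ ρ
  ⟦ φ ∨̇ ψ ⟧ ρ = ⟦ φ ⟧ ρ ⊎ ⟦ ψ ⟧ ρ
  ⟦ φ ⇒̇ ψ ⟧ ρ = ⟦ φ ⟧ ρ → ⟦ ψ ⟧ ρ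
  ⟦ ∃̇ φ ⟧   ρ = ∃[ a ] ⟦ φ ⟧ (a ∷ ρ)
  ⟦ ∀̇ φ ⟧   ρ = ∀ a → ⟦ φ ⟧ (a ∷ ρ)

infix 4 _⊨_ _≡[_]_

_⊨_ : ∀ {d} → ColoredOrdinal d → Sentence d → Set
𝔄 ⊨ φ = ⟦_⟧ 𝔄 φ []

_≡[_]_ : ∀ {d} → ColoredOrdinal d → ℕ → ColoredOrdinal d → Set
_≡[_]_ {d} 𝔄 q 𝔅 = (φ : Sentence d) → qr φ ≤ q → 𝔄 ⊨ φ ⇔ 𝔅 ⊨ φ

-- σ is a q-characteristic sentence of the ≡[ q ]-class of 𝔄.
IsCharacteristic : ∀ {d} → ℕ → Sentence d → ColoredOrdinal d → Set₁
IsCharacteristic q σ 𝔄 = qr σ ≤ q × (∀ 𝔅 → 𝔅 ⊨ σ ⇔ 𝔅 ≡[ q ] 𝔄)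

-- A possible choice of Σ_d(q), listed without repetition (by the uniqueness
-- in `complete`), so that `size` is its cardinality.
record CharacteristicSet (d q : ℕ) : Set₁ where
  field
    size     : ℕ
    sentence : Fin size → Sentence d
    sound    : ∀ i → ∃[ 𝔄 ] IsCharacteristic q (sentence i) 𝔄
    complete : ∀ 𝔄 → ∃[ i ] IsCharacteristic q (sentence i) 𝔄 ×
                            (∀ j → IsCharacteristic q (sentence j) 𝔄 → i ≡ j)

∣_∣ : ∀ {d q} → CharacteristicSet d q → ℕ
∣_∣ = CharacteristicSet.size

IsMin : (WellOrder → Set₁) → WellOrder → Set₁
IsMin P μ = P μ × (∀ α → P α → μ ≤ᵒ α)

IsMax : (WellOrder → Set₁) → WellOrder → Set₁
IsMax P μ = P μ × (∀ α → P α → α ≤ᵒ μ)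

ModelOrderType : ∀ {d} → Sentence d → WellOrder → Set₁
ModelOrderType {d} σ α = Σ (ColoredOrdinal d) λ 𝔄 → 𝔄 ⊨ σ × otp 𝔄 ≅ᵒ α

-- γ represents g_ord(d,q) = max_{σ ∈ Σ_d(q)} min { otp 𝔄 : 𝔄 ⊨ σ }.
IsGOrd : ∀ {d q} → CharacteristicSet d q → WellOrder → Set₁
IsGOrd S = IsMax λ α → ∃[ i ] IsMin (ModelOrderType (sentence i)) α
  where open CharacteristicSet S

{-# OPTIONS --safe #-}
-- Let τ₀, …, τₘ be the characteristic sentences of the (d - 1)-colored ordinals, and use
-- the remaining color for separators.  A separator has type k if the points between it and
-- the next separator form a model of τₖ.  Say that type m is cofinal and that every
-- separator of type k + 1 is a limit of separators of type k.  By induction on k, every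
-- nonempty interval ending in a separator of type k embeds ω^k, so that every nonempty
-- model embeds ω^(m + 1).  A model is obtained from ω^(m + 1) by putting a model of τₖ at
-- each point whose least exponent is k: distinct characteristic sentences exclude each
-- other, so that the types are the intended ones.  With three quantifiers in front and
-- one for relativizing τₖ to its interval, the quantifier rank grows by 4.
--
-- For the second estimate, the three colors needed to treat 2-colored blocks are coded by
-- the words 0, 01 and 011, which three more quantifiers can tell apart.
module Submission where

open import Defs
open import Axiom.ExcludedMiddle using (ExcludedMiddle)
open import Data.Empty using (⊥-elim)
open import Data.Fin using (Fin; zero; suc; toℕ; fromℕ; inject₁)
import Data.Fin as Fin
import Data.Fin.Induction as Fin
import Data.Fin.Properties as Fin
open import Data.Irrelevant using ([_])
open import Data.Maybe using (Maybe; just; nothing; fromMaybe)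
open import Data.Nat using (ℕ; zero; suc; _+_; _∸_; _⊔_; _≤_; z≤n; s≤s)
import Data.Nat as ℕ
import Data.Nat.Properties as ℕ
open import Data.Product using (Σ; ∃; ∃-syntax; _×_; _,_; proj₁; proj₂)
import Data.Product as Product
open import Data.Refinement using (Refinement; value; value-injective) renaming (_,_ to _,ʳ_)
open import Data.Sum using (_⊎_; inj₁; inj₂)
import Data.Sum as Sum
open import Data.Unit using (⊤; tt)
open import Data.Vec using (Vec; []; _∷_; lookup)
open import Function using (_∘_; id; _on_; case_of_; _⇔_; mk⇔; Equivalence)
open import Function.Properties.Equivalence using ()
  renaming (refl to ⇔-refl; sym to ⇔-sym; trans to ⇔-trans)
open import Induction.WellFounded using (WellFounded; WfRec; Acc; acc; wf⇒asym; module All)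
open import Level using (0ℓ; Lift; lift; lower)
import Level
import Relation.Binary.Construct.On as On
open import Relation.Binary.Construct.Add.Infimum.Strict
  using (_<₋_; ⊥₋<[_]; [_]; <₋-wellFounded; <₋-isStrictTotalOrder-≡)
open import Relation.Binary.Core using (Rel)
open import Relation.Binary.Definitions using (Tri; tri<; tri≈; tri>)
open import Relation.Binary.Morphism.Structures using (IsOrderMonomorphism; IsOrderIsomorphism)
open import Relation.Binary.PropositionalEquality
open import Relation.Binary.Structures using (IsStrictTotalOrder)
open import Relation.Nullary using (¬_; Dec; yes; no; contradiction)
open import Relation.Nullary.Construct.Add.Infimum using (_₋; ⊥₋; [_])
open import Relation.Nullary.Decidable using (recompute; map′; decidable-stable)

open Equivalence using (to; from)

-- Well-orders, suborders and strictly increasing maps.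

module WO (α : WellOrder) where
  open WellOrder α public
  open IsStrictTotalOrder isStrictTotalOrder public
    using (compare; _<?_) renaming (trans to <-trans)

  irrefl : ∀ {x} → ¬ x < x
  irrefl = IsStrictTotalOrder.irrefl isStrictTotalOrder refl

strictTotalOrder : ∀ {A : Set} {_<_ : Rel A 0ℓ} → WellFounded _<_ →
  (∀ {x y z} → x < y → y < z → x < z) → (∀ x y → x < y ⊎ x ≡ y ⊎ y < x) →
  IsStrictTotalOrder _≡_ _<_
strictTotalOrder {_<_ = _<_} wf trans connex = record
  { isStrictPartialOrder = record
    { isEquivalence = isEquivalence
    ; irrefl        = λ { refl x<x → asym x<x x<x }
    ; trans         = trans
    ; <-resp-≈      = resp₂ _<_
    }
  ; compare = λ x y → tri (connex x y)
  }
  where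
  asym = wf⇒asym wf
  tri : ∀ {x y} → x < y ⊎ x ≡ y ⊎ y < x → Tri (x < y) (x ≡ y) (y < x)
  tri (inj₁ x<y)         = tri< x<y (λ { refl → asym x<y x<y }) (asym x<y)
  tri (inj₂ (inj₁ refl)) = tri≈ (λ x<x → asym x<x x<x) refl (λ x<x → asym x<x x<x)
  tri (inj₂ (inj₂ y<x))  = tri> (asym y<x) (λ { refl → asym y<x y<x }) y<x

-- Membership in P is stored irrelevantly, so that the points of the suborder
-- are determined by their values.
sub : (α : WellOrder) → (WellOrder.Carrier α → Set) → WellOrder
sub α P = record
  { Carrier            = Refinement Carrier P
  ; _<_                = _<_ on value
  ; isStrictTotalOrder = strictTotalOrder wf <-trans connex
  ; wellFounded        = wf
  }
  where
  open WO α
  wf = On.wellFounded value wellFounded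
  connex : ∀ x y → value x < value y ⊎ x ≡ y ⊎ value y < value x
  connex x y with compare (value x) (value y)
  ... | tri< x<y _ _ = inj₁ x<y
  ... | tri≈ _ x≡y _ = inj₂ (inj₁ (value-injective x≡y))
  ... | tri> _ _ y<x = inj₂ (inj₂ y<x)

segment : (α : WellOrder) → WellOrder.Carrier α → WellOrder
segment α a = sub α (λ x → WellOrder._<_ α x a)

infix 4 _↪_

record _↪_ (α β : WellOrder) : Set where
  constructor mk↪
  private
    module α = WellOrder α
    module β = WellOrder β
  field
    to   : α.Carrier → β.Carrier
    mono : ∀ {x y} → x α.< y → to x β.< to y

↪-trans : ∀ {α β γ} → α ↪ β → β ↪ γ → α ↪ γ
↪-trans (mk↪ f f-mono) (mk↪ g g-mono) = mk↪ (g ∘ f) (g-mono ∘ f-mono)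

≤ᵒ⇒↪ : ∀ {α β} → α ≤ᵒ β → α ↪ β
≤ᵒ⇒↪ (f , f-mono , _) = mk↪ f (IsOrderMonomorphism.mono f-mono)

≅ᵒ⇒↪ : ∀ {α β} → α ≅ᵒ β → α ↪ β
≅ᵒ⇒↪ (f , f-iso) = mk↪ f (IsOrderIsomorphism.mono f-iso)

sub-↪ : ∀ α P → sub α P ↪ α
sub-↪ α P = mk↪ value id

module _ {α β : WellOrder} where
  private
    module α = WO α
    module β = WO β

  ↪⇒monomorphism : ((mk↪ f _) : α ↪ β) → IsOrderMonomorphism _≡_ _≡_ α._<_ β._<_ f
  ↪⇒monomorphism (mk↪ f mono) = record
    { isOrderHomomorphism = record { cong = cong f ; mono = mono }
    ; injective           = injective
    ; cancel              = cancel
    }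
    where
    injective : ∀ {x y} → f x ≡ f y → x ≡ y
    injective {x} {y} fx≡fy with α.compare x y
    ... | tri< x<y _ _ = contradiction (subst (β._< f y) fx≡fy (mono x<y)) β.irrefl
    ... | tri≈ _ x≡y _ = x≡y
    ... | tri> _ _ y<x = contradiction (subst (f y β.<_) fx≡fy (mono y<x)) β.irrefl
    cancel : ∀ {x y} → f x β.< f y → x α.< y
    cancel {x} {y} fx<fy with α.compare x y
    ... | tri< x<y _ _  = x<y
    ... | tri≈ _ refl _ = contradiction fx<fy β.irrefl
    ... | tri> _ _ y<x  = contradiction (β.<-trans fx<fy (mono y<x)) β.irrefl

≅ᵒ-refl : ∀ {α} → α ≅ᵒ α
≅ᵒ-refl {α} = id , record
  { isOrderMonomorphism = ↪⇒monomorphism {α} {α} (mk↪ id id)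
  ; surjective          = λ y → y , id
  }

≅ᵒ-trans : ∀ {α β γ} → α ≅ᵒ β → β ≅ᵒ γ → α ≅ᵒ γ
≅ᵒ-trans {α} {β} {γ} (f , f-iso) (g , g-iso) = g ∘ f , record
  { isOrderMonomorphism =
      ↪⇒monomorphism {α} {γ} (mk↪ (g ∘ f) (G.mono ∘ F.mono))
  ; surjective = λ z → let (y , g-y) = G.surjective z ; (x , f-x) = F.surjective y in
      x , λ { refl → g-y (f-x refl) }
  }
  where
  module F = IsOrderIsomorphism f-iso
  module G = IsOrderIsomorphism g-iso

-- x ↦ f x cannot decrease any x, or else x, f x, f (f x), … would descend forever.
expansive : ∀ {α} ((mk↪ f _) : α ↪ α) → ∀ x → ¬ WellOrder._<_ α (f x) x
expansive {α} (mk↪ f mono) = All.wfRec wellFounded 0ℓ (λ x → ¬ f x < x)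
  λ x rec fx<x → rec fx<x (mono fx<x)
  where open WellOrder α

-- Viewed as a map from `α` to itself, such an embedding sends `a` below `a`, against `expansive`.
¬-↪-segment : ∀ {α a} → ¬ α ↪ segment α a
¬-↪-segment {α} {a} (mk↪ f mono) = expansive {α} (mk↪ (value ∘ f) mono) a (below (f a))
  where
  open WO α
  below : ∀ (x : Refinement Carrier (_< a)) → value x < a
  below (x ,ʳ [ x<a ]) = recompute (x <? a) x<a

-- Comparability of well-orders and existence of minima.

module Comparison (α β : WellOrder) where
  private
    module α = WO α
    module β = WO β

  infix 4 _~_

  -- a ~ b means that the segments below a and b are isomorphic.
  data _~_ : α.Carrier → β.Carrier → Set where
    match : ∀ {a b} →
      (∀ {a′} → a′ α.< a → ∃[ b′ ] b′ β.< b × a′ ~ b′) →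
      (∀ {b′} → b′ β.< b → ∃[ a′ ] a′ α.< a × a′ ~ b′) → a ~ b

  forth : ∀ {a b a′} → a ~ b → a′ α.< a → ∃[ b′ ] b′ β.< b × a′ ~ b′
  forth (match f _) = f

  back : ∀ {a b b′} → a ~ b → b′ β.< b → ∃[ a′ ] a′ α.< a × a′ ~ b′
  back (match _ g) = g

  Matched : α.Carrier → Set
  Matched a = ∃[ b ] a ~ b

  -- If `b < b′`, going back from `b` along `a ~ b′` and forth along `a ~ b` gives an `x < a`
  -- matched both with `b` and with some `y < b`, against the induction hypothesis at `x`.
  functional : ∀ a {b b′} → a ~ b → a ~ b′ → b ≡ b′
  functional = All.wfRec α.wellFounded 0ℓ (λ a → ∀ {b b′} → a ~ b → a ~ b′ → b ≡ b′) step
    where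
    step : ∀ a → (∀ {x} → x α.< a → ∀ {b b′} → x ~ b → x ~ b′ → b ≡ b′) →
      ∀ {b b′} → a ~ b → a ~ b′ → b ≡ b′
    step a rec {b} {b′} a~b a~b′ with β.compare b b′
    ... | tri≈ _ b≡b′ _ = b≡b′
    ... | tri< b<b′ _ _ with back a~b′ b<b′
    ...   | x , x<a , x~b with forth a~b x<a
    ...     | y , y<b , x~y = contradiction (subst (β._< b) (rec x<a x~y x~b) y<b) β.irrefl
    step a rec {b} {b′} a~b a~b′ | tri> _ _ b′<b with back a~b b′<b
    ...   | x , x<a , x~b′ with forth a~b′ x<a
    ...     | y , y<b′ , x~y = contradiction (subst (β._< b′) (rec x<a x~y x~b′) y<b′) β.irrefl

  monotone : ∀ {a a′ b b′} → a ~ b → a′ ~ b′ → a α.< a′ → b β.< b′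
  monotone a~b a′~b′ a<a′ with forth a′~b′ a<a′
  ... | y , y<b′ , a~y = subst (β._< _) (functional _ a~y a~b) y<b′

  reflects : ∀ {a a′ b b′} → a ~ b → a′ ~ b′ → b β.< b′ → a α.< a′
  reflects {a} {a′} a~b a′~b′ b<b′ with α.compare a a′
  ... | tri< a<a′ _ _  = a<a′
  ... | tri≈ _ refl _  = contradiction (subst (β._< _) (functional a a~b a′~b′) b<b′) β.irrefl
  ... | tri> _ _ a′<a  = contradiction (β.<-trans b<b′ (monotone a′~b′ a~b a′<a)) β.irrefl

  injective : ∀ {a a′ b} → a ~ b → a′ ~ b → a ≡ a′
  injective {a} {a′} a~b a′~b with α.compare a a′
  ... | tri< a<a′ _ _ = contradiction (monotone a~b a′~b a<a′) β.irrefl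
  ... | tri≈ _ a≡a′ _ = a≡a′
  ... | tri> _ _ a′<a = contradiction (monotone a′~b a~b a′<a) β.irrefl

module Classical (em : ExcludedMiddle (Level.suc 0ℓ)) where

  decide : (P : Set) → Dec P
  decide P = map′ lower lift (em {Lift (Level.suc 0ℓ) P})

  proof : {A : Set} {P : A → Set} (x : Refinement A P) → P (value x)
  proof (_ ,ʳ [ Px ]) = recompute (decide _) Px

  stable : {P : Set} → ¬ ¬ P → P
  stable = decidable-stable (decide _)

  least : ∀ α (P : WellOrder.Carrier α → Set₁) → ∃ P →
    ∃[ a ] P a × (∀ {x} → WellOrder._<_ α x a → ¬ P x)
  least α P (a , Pa) = All.wfRec wellFounded _ (λ a → P a → Least) step a Pa
    where
    open WellOrder α
    Least = ∃[ a ] P a × (∀ {x} → x < a → ¬ P x)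
    step : ∀ a → (∀ {x} → x < a → P x → Least) → P a → Least
    step a rec Pa with em {∃[ x ] x < a × P x}
    ... | yes (x , x<a , Px) = rec x<a Px
    ... | no none            = a , Pa , λ x<a Px → none (_ , x<a , Px)

  -- If every point of `α` is matched, matching is the required map. Otherwise the points below the
  -- least unmatched `a` exhaust `β`: a least `b` missed by them would match `a`.
  comparable : ∀ α β → α ≤ᵒ β ⊎ ∃[ a ] β ≅ᵒ segment α a
  comparable α β with decide (∃[ a ] ¬ Comparison.Matched α β a)
  ... | no total = inj₁ (proj₁ ∘ image , ↪⇒monomorphism {α} {β} (mk↪ _ mono) , initial)
    where
    open Comparison α β
    open WellOrder β
    image : ∀ a → ∃[ b ] a ~ b
    image a = stable λ none → total (a , none)
    mono : ∀ {x y} → WellOrder._<_ α x y → proj₁ (image x) < proj₁ (image y)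
    mono = monotone (proj₂ (image _)) (proj₂ (image _))
    initial : ∀ a b → b < proj₁ (image a) → ∃[ a′ ] proj₁ (image a′) ≡ b
    initial a b b<fa with back (proj₂ (image a)) b<fa
    ... | x , _ , x~b = x , functional x (proj₂ (image x)) x~b
  ... | yes unmatched with least α (λ a → Lift (Level.suc 0ℓ) (¬ Comparison.Matched α β a))
          (proj₁ unmatched , lift (proj₂ unmatched))
  ...   | a , lift a-unmatched , below = inj₂ (a , proj₁ ∘ preimage , record
    { isOrderMonomorphism = ↪⇒monomorphism {β} {segment α a} (mk↪ _ mono)
    ; surjective          = surjective
    })
    where
    open Comparison α β
    module α = WO α
    module β = WO β
    image : ∀ {x} → x α.< a → ∃[ b ] x ~ b
    image x<a = stable λ none → below x<a (lift none)

    surjects : ∀ b → ∃[ x ] x α.< a × x ~ b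
    surjects = All.wfRec β.wellFounded 0ℓ _ step
      where
      step : ∀ b → (∀ {y} → y β.< b → ∃[ x ] x α.< a × x ~ y) → ∃[ x ] x α.< a × x ~ b
      step b rec = stable λ none → a-unmatched (b , match (image-below none) rec)
        where
        image-below : ¬ (∃[ x ] x α.< a × x ~ b) → ∀ {x} → x α.< a → ∃[ y ] y β.< b × x ~ y
        image-below none {x} x<a with image x<a
        ... | y , x~y with β.compare y b
        ...   | tri< y<b _ _  = y , y<b , x~y
        ...   | tri≈ _ refl _ = contradiction (x , x<a , x~y) none
        ...   | tri> _ _ b<y with back x~y b<y
        ...     | x′ , x′<x , x′~b = contradiction (x′ , α.<-trans x′<x x<a , x′~b) none

    preimage : ∀ b → Σ (WellOrder.Carrier (segment α a)) λ x → value x ~ b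
    preimage b with surjects b
    ... | x , x<a , x~b = (x ,ʳ [ x<a ]) , x~b
    mono : ∀ {x y} → x β.< y → value (proj₁ (preimage x)) α.< value (proj₁ (preimage y))
    mono {x} {y} = reflects (proj₂ (preimage x)) (proj₂ (preimage y))
    surjective : ∀ (x : WellOrder.Carrier (segment α a)) →
      ∃[ b ] (∀ {z} → z ≡ b → proj₁ (preimage z) ≡ x)
    surjective (x ,ʳ [ x<a ]) with image (recompute (x α.<? a) x<a)
    ... | b , x~b = b , λ { refl → value-injective (injective (proj₂ (preimage b)) x~b) }

  -- In the other case of comparability `α` would embed into a proper segment of itself.
  ↪⇒≤ᵒ : ∀ {α β} → α ↪ β → α ≤ᵒ β
  ↪⇒≤ᵒ {α} {β} f with comparable α β
  ... | inj₁ α≤β       = α≤β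
  ... | inj₂ (a , iso) = ⊥-elim (¬-↪-segment (↪-trans f (≅ᵒ⇒↪ iso)))

  -- By comparability, an order below the given witness `α` is isomorphic to a segment of `α`. So
  -- the least segment satisfying `P`, or `α` itself if there is none, is minimal.
  minimum : (P : WellOrder → Set₁) → (∀ {α β} → α ≅ᵒ β → P α → P β) → ∃ P → ∃ (IsMin P)
  minimum P resp (α , Pα) with em {∃[ a ] P (segment α a)}
  ... | no none = α , Pα , minimal
    where
    minimal : ∀ β → P β → α ≤ᵒ β
    minimal β Pβ with comparable α β
    ... | inj₁ α≤β       = α≤β
    ... | inj₂ (a , iso) = contradiction (a , resp {β} iso Pβ) none
  ... | yes some with least α (P ∘ segment α) some
  ...   | a , Pa , below = segment α a , Pa , minimal
    where
    minimal : ∀ β → P β → segment α a ≤ᵒ β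
    minimal β Pβ with comparable (segment α a) β
    ... | inj₁ ≤β = ≤β
    ... | inj₂ ((x ,ʳ [ x<a ]) , iso) =
      contradiction (resp {β} (≅ᵒ-trans {β} {γ} {segment α x} iso flatten) Pβ) (below x<a′)
      where
      open WO α
      x<a′ = recompute (x <? a) x<a
      γ = segment (segment α a) (x ,ʳ [ x<a ])
      -- A segment of a segment is the segment of `α` cut at `x < a`, against the choice of `a`.
      flatten : γ ≅ᵒ segment α x
      flatten = forget , record
        { isOrderMonomorphism =
            ↪⇒monomorphism {γ} {segment α x} (mk↪ forget id)
        ; surjective = λ { (y ,ʳ [ y<x ]) →
            ((y ,ʳ [ <-trans (recompute (y <? x) y<x) x<a′ ]) ,ʳ [ y<x ]) , λ { refl → refl } }
        }
        where
        forget : WellOrder.Carrier γ → WellOrder.Carrier (segment α x)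
        forget ((y ,ʳ _) ,ʳ [ y<x ]) = y ,ʳ [ y<x ]

-- Interpretations and quantifier rank.

-- An interpretation of e-colored orders in d-colored orders: domain and colors are
-- given by formulas in one variable and m parameters.
module Translation {d e m : ℕ}
  (dom : ∀ {k} → (Fin m → Fin k) → Fin k → Formula d k)
  (col : ∀ {k} → Fin e → (Fin m → Fin k) → Fin k → Formula d k) where

  translate : ∀ {n k} → (Fin m → Fin k) → (Fin n → Fin k) → Formula e n → Formula d k
  translate π σ (x ≐ y) = σ x ≐ σ y
  translate π σ (x ≺ y) = σ x ≺ σ y
  translate π σ (C i x) = col i π (σ x)
  translate π σ ⊥̇       = ⊥̇
  translate π σ (φ ∧̇ ψ) = translate π σ φ ∧̇ translate π σ ψ
  translate π σ (φ ∨̇ ψ) = translate π σ φ ∨̇ translate π σ ψ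
  translate π σ (φ ⇒̇ ψ) = translate π σ φ ⇒̇ translate π σ ψ
  translate π σ (∃̇ φ)   = ∃̇ (dom (suc ∘ π) zero ∧̇ translate (suc ∘ π) (Fin.lift 1 σ) φ)
  translate π σ (∀̇ φ)   = ∀̇ (dom (suc ∘ π) zero ⇒̇ translate (suc ∘ π) (Fin.lift 1 σ) φ)

  module _ (b : ℕ)
    (qr-dom : ∀ {k} (π : Fin m → Fin k) x → qr (dom π x) ≤ b)
    (qr-col : ∀ {k} i (π : Fin m → Fin k) x → qr (col i π x) ≤ b) where

    private
      qr-⊔ : ∀ {x y} m n → x ≤ m + b → y ≤ n + b → x ⊔ y ≤ (m ⊔ n) + b
      qr-⊔ m n x≤ y≤ = subst (_ ≤_) (sym (ℕ.+-distribʳ-⊔ b m n)) (ℕ.⊔-mono-≤ x≤ y≤)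

    -- The domain formula stands beside the translated body, not around it, so nested quantifiers
    -- add the bound `b` only once.
    qr-translate : ∀ {n k} (π : Fin m → Fin k) (σ : Fin n → Fin k) φ →
      qr (translate π σ φ) ≤ qr φ + b
    qr-translate π σ (x ≐ y) = z≤n
    qr-translate π σ (x ≺ y) = z≤n
    qr-translate π σ (C i x) = qr-col i π (σ x)
    qr-translate π σ ⊥̇       = z≤n
    qr-translate π σ (φ ∧̇ ψ) = qr-⊔ (qr φ) (qr ψ) (qr-translate π σ φ) (qr-translate π σ ψ)
    qr-translate π σ (φ ∨̇ ψ) = qr-⊔ (qr φ) (qr ψ) (qr-translate π σ φ) (qr-translate π σ ψ)
    qr-translate π σ (φ ⇒̇ ψ) = qr-⊔ (qr φ) (qr ψ) (qr-translate π σ φ) (qr-translate π σ ψ)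
    qr-translate π σ (∃̇ φ)   =
      s≤s (ℕ.⊔-lub (ℕ.m≤n⇒m≤o+n (qr φ) (qr-dom _ _)) (qr-translate _ _ φ))
    qr-translate π σ (∀̇ φ)   =
      s≤s (ℕ.⊔-lub (ℕ.m≤n⇒m≤o+n (qr φ) (qr-dom _ _)) (qr-translate _ _ φ))

  -- h identifies 𝔄 with the structure that the interpretation defines in 𝔅 from
  -- the parameters p.
  record Realizes (𝔄 : ColoredOrdinal e) (𝔅 : ColoredOrdinal d)
    (p : Fin m → ColoredOrdinal.Carrier 𝔅)
    (h : ColoredOrdinal.Carrier 𝔄 → ColoredOrdinal.Carrier 𝔅) : Set where
    private
      module 𝔄 = ColoredOrdinal 𝔄
      module 𝔅 = ColoredOrdinal 𝔅
    field
      h-mono   : ∀ {x y} → x 𝔄.< y → h x 𝔅.< h y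
      dom-spec : ∀ {k} {ρ : Vec 𝔅.Carrier k} {π} x → (∀ j → lookup ρ (π j) ≡ p j) →
        ⟦ 𝔅 ⟧ (dom π x) ρ ⇔ (∃[ a ] h a ≡ lookup ρ x)
      col-spec : ∀ {k} {ρ : Vec 𝔅.Carrier k} {π} i x a → (∀ j → lookup ρ (π j) ≡ p j) →
        lookup ρ x ≡ h a → ⟦ 𝔅 ⟧ (col i π x) ρ ⇔ 𝔄.color a ≡ i

  module _ {𝔄 : ColoredOrdinal e} {𝔅 : ColoredOrdinal d}
    {p : Fin m → ColoredOrdinal.Carrier 𝔅}
    {h : ColoredOrdinal.Carrier 𝔄 → ColoredOrdinal.Carrier 𝔅}
    (realizes : Realizes 𝔄 𝔅 p h) where
    open Realizes realizes
    private
      module 𝔄 = ColoredOrdinal 𝔄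
      module 𝔅 = ColoredOrdinal 𝔅
      module h = IsOrderMonomorphism (↪⇒monomorphism {𝔄.otp} {𝔅.otp} (mk↪ h h-mono))

    private
      atom : (R : Rel 𝔅.Carrier 0ℓ) {S : Set} {x y x′ y′ : 𝔅.Carrier} →
        x ≡ x′ → y ≡ y′ → S ⇔ R x′ y′ → S ⇔ R x y
      atom R refl refl = id

    translate-spec : ∀ {n k} {ρ : Vec 𝔄.Carrier n} {ρ′ : Vec 𝔅.Carrier k} {π σ} φ →
      (∀ j → lookup ρ′ (π j) ≡ p j) → (∀ i → lookup ρ′ (σ i) ≡ h (lookup ρ i)) →
      ⟦ 𝔄 ⟧ φ ρ ⇔ ⟦ 𝔅 ⟧ (translate π σ φ) ρ′
    translate-spec (x ≐ y) ρπ ρσ = atom _≡_ (ρσ x) (ρσ y) (mk⇔ (cong h) h.injective)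
    translate-spec (x ≺ y) ρπ ρσ = atom 𝔅._<_ (ρσ x) (ρσ y) (mk⇔ h-mono h.cancel)
    translate-spec (C i x) ρπ ρσ = ⇔-sym (col-spec i _ _ ρπ (ρσ x))
    translate-spec ⊥̇       ρπ ρσ = ⇔-refl
    translate-spec (φ ∧̇ ψ) ρπ ρσ = let f = translate-spec φ ρπ ρσ ; g = translate-spec ψ ρπ ρσ in
      mk⇔ (Product.map (to f) (to g)) (Product.map (from f) (from g))
    translate-spec (φ ∨̇ ψ) ρπ ρσ = let f = translate-spec φ ρπ ρσ ; g = translate-spec ψ ρπ ρσ in
      mk⇔ (Sum.map (to f) (to g)) (Sum.map (from f) (from g))
    translate-spec (φ ⇒̇ ψ) ρπ ρσ = let f = translate-spec φ ρπ ρσ ; g = translate-spec ψ ρπ ρσ in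
      mk⇔ (λ p → to g ∘ p ∘ from f) (λ p → from g ∘ p ∘ to f)
    translate-spec {ρ = ρ} {ρ′} {π} {σ} (∃̇ φ) ρπ ρσ = mk⇔
      (λ (a , s) → h a , from (dom-spec zero ρπ) (a , refl) , to (body a) s)
      (λ { (b , in-dom , s) → case to (dom-spec zero ρπ) in-dom of λ
        { (a , refl) → a , from (body a) s } })
      where
      body : ∀ a → ⟦ 𝔄 ⟧ φ (a ∷ ρ) ⇔ ⟦ 𝔅 ⟧ (translate (suc ∘ π) (Fin.lift 1 σ) φ) (h a ∷ ρ′)
      body a = translate-spec φ ρπ λ { zero → refl ; (suc i) → ρσ i }
    translate-spec {ρ = ρ} {ρ′} {π} {σ} (∀̇ φ) ρπ ρσ = mk⇔
      (λ s b in-dom → case to (dom-spec zero ρπ) in-dom of λ { (a , refl) → to (body a) (s a) })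
      (λ s a → from (body a) (s (h a) (from (dom-spec zero ρπ) (a , refl))))
      where
      body : ∀ a → ⟦ 𝔄 ⟧ φ (a ∷ ρ) ⇔ ⟦ 𝔅 ⟧ (translate (suc ∘ π) (Fin.lift 1 σ) φ) (h a ∷ ρ′)
      body a = translate-spec φ ρπ λ { zero → refl ; (suc i) → ρσ i }

⋀ : ∀ {d n} m → (Fin m → Formula d n) → Formula d n
⋀ zero    φ = ⊥̇ ⇒̇ ⊥̇
⋀ (suc m) φ = φ zero ∧̇ ⋀ m (φ ∘ suc)

qr-⋀ : ∀ {d n b} m (φ : Fin m → Formula d n) → (∀ i → qr (φ i) ≤ b) → qr (⋀ m φ) ≤ b
qr-⋀ zero    φ qr≤b = z≤n
qr-⋀ (suc m) φ qr≤b = ℕ.⊔-lub (qr≤b zero) (qr-⋀ m (φ ∘ suc) (qr≤b ∘ suc))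

⋀-spec : ∀ {d n} {𝔄 : ColoredOrdinal d} {ρ} m (φ : Fin m → Formula d n) →
  ⟦ 𝔄 ⟧ (⋀ m φ) ρ ⇔ (∀ i → ⟦ 𝔄 ⟧ (φ i) ρ)
⋀-spec zero    φ = mk⇔ (λ _ ()) (λ _ ())
⋀-spec (suc m) φ = mk⇔
  (λ { (s , t) zero → s ; (s , t) (suc i) → to (⋀-spec m (φ ∘ suc)) t i })
  (λ s → s zero , from (⋀-spec m (φ ∘ suc)) (s ∘ suc))

-- Embedding powers of `ω` by climbing through limits.

module Climbing (β : WellOrder) where
  open WO β

  infix 4 _≼_
  _≼_ : Rel Carrier 0ℓ
  x ≼ y = x < y ⊎ x ≡ y

  <-≼-trans : ∀ {x y z} → x < y → y ≼ z → x < z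
  <-≼-trans x<y (inj₁ y<z)  = <-trans x<y y<z
  <-≼-trans x<y (inj₂ refl) = x<y

  ≼-trans : ∀ {x y z} → x ≼ y → y ≼ z → x ≼ z
  ≼-trans (inj₁ x<y)  y≼z = inj₁ (<-≼-trans x<y y≼z)
  ≼-trans (inj₂ refl) y≼z = y≼z

  -- Closed below and open above: consecutive intervals can be concatenated, and the lower end
  -- itself serves for exponent 0.
  PowerBetween : ℕ → Rel Carrier 0ℓ
  PowerBetween k y z = Σ (ω^ k ↪ β) λ f → ∀ a → y ≼ _↪_.to f a × _↪_.to f a < z

  -- Iterating `next` gives an increasing sequence; copies of `ω^ k` between consecutive members add
  -- up to `ω^ suc k`. The condition `Q` keeps the sequence in bounds: it is `_< z` below a limit
  -- and trivial in the whole order.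
  climb : ∀ k {P Q : Carrier → Set} →
    (∀ {x y} → x < y → Q y → Q x) →
    (∀ {y z} → y < z → P z → PowerBetween k y z) →
    (∀ {y} → Q y → ∃[ z ] y < z × Q z × P z) →
    ∀ {y} → Q y → Σ (ω^ suc k ↪ β) λ f → ∀ a → y ≼ _↪_.to f a × Q (_↪_.to f a)
  climb k {P} {Q} Q-down power next {y} Qy = mk↪ f f-mono , bounds
    where
    w : ℕ → ∃ Q
    w zero    = y , Qy
    w (suc i) = let (z , _ , Qz , _) = next (proj₂ (w i)) in z , Qz

    w< : ∀ i → proj₁ (w i) < proj₁ (w (suc i))
    w< i = let (_ , wᵢ<z , _) = next (proj₂ (w i)) in wᵢ<z

    w≼′ : ∀ i {j} → i ℕ.≤′ j → proj₁ (w i) ≼ proj₁ (w j)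
    w≼′ i ℕ.≤′-refl               = inj₂ refl
    w≼′ i (ℕ.≤′-step {n = n} i≤j) = ≼-trans (w≼′ i i≤j) (inj₁ (w< n))

    w≼ : ∀ {i j} → i ≤ j → proj₁ (w i) ≼ proj₁ (w j)
    w≼ {i} i≤j = w≼′ i (ℕ.≤⇒≤′ i≤j)

    piece : ∀ i → PowerBetween k (proj₁ (w i)) (proj₁ (w (suc i)))
    piece i = let (_ , _ , _ , Pz) = next (proj₂ (w i)) in power (w< i) Pz

    f : WellOrder.Carrier (ω^ suc k) → Carrier
    f (i , a) = _↪_.to (proj₁ (piece i)) a

    f-mono : ∀ {x y} → WellOrder._<_ (ω^ suc k) x y → f x < f y
    f-mono {i , a} {j , b} (inj₁ i<j) =
      <-≼-trans (proj₂ (proj₂ (piece i) a))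
        (≼-trans (w≼ {suc i} {j} i<j) (proj₁ (proj₂ (piece j) b)))
    f-mono {i , _} (inj₂ (refl , a<b)) = _↪_.mono (proj₁ (piece i)) a<b

    bounds : ∀ x → y ≼ f x × Q (f x)
    bounds (i , a) = let (above , below) = proj₂ (piece i) a in
      ≼-trans (w≼ {0} {i} ℕ.z≤n) above , Q-down below (proj₂ (w (suc i)))

  module _ {m} (P : Fin (suc m) → Carrier → Set)
    (limit : ∀ k {y z} → y < z → P (suc k) z → ∃[ w ] y < w × w < z × P (inject₁ k) w) where

    -- Induction on `k`: by `limit`, points of type `inject₁ k` occur arbitrarily close below a
    -- point of type `suc k`, so `climb` applies between `y` and `z`.
    power-below : ∀ k {y z} → y < z → P k z → PowerBetween (toℕ k) y z
    power-below = Fin.<-weakInduction _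
      (λ {y} y<z _ → mk↪ (λ _ → y) (λ { {zero} {zero} () }) , λ _ → inj₂ refl , y<z)
      (λ k ih {z = z} y<z Pz → climb (toℕ k) {P (inject₁ k)} {_< z} <-trans
        (subst (λ i → ∀ {y z} → y < z → P (inject₁ k) z → PowerBetween i y z)
          (Fin.toℕ-inject₁ k) ih)
        (λ x<z → limit k x<z Pz) y<z)

    power-embeds : (∀ y → ∃[ z ] y < z × P (fromℕ m) z) → Carrier → ω^ suc m ↪ β
    power-embeds cofinal y = proj₁ (climb m {P (fromℕ m)} {λ _ → ⊤} (λ _ _ → tt)
      (subst (λ i → ∀ {y z} → y < z → P (fromℕ m) z → PowerBetween i y z)
        (Fin.toℕ-fromℕ m) (power-below (fromℕ m)))
      (λ {y} _ → let (z , y<z , Pz) = cofinal y in z , y<z , tt , Pz) {y} tt)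

-- The ladder sentence and its models.

restrict : ∀ {d e} (𝔅 : ColoredOrdinal d) → (ColoredOrdinal.Carrier 𝔅 → Set) →
  (ColoredOrdinal.Carrier 𝔅 → Fin e) → ColoredOrdinal e
restrict 𝔅 D c = record { otp = sub (ColoredOrdinal.otp 𝔅) D ; color = c ∘ value }

-- In the ladder formulas, color 0 marks separators, and the block of a separator z
-- consists of the points between z and the next separator.
module Ladder (e : ℕ) where

  block-dom : ∀ {k} → (Fin 1 → Fin k) → Fin k → Formula (suc e) k
  block-dom π x = π zero ≺ x ∧̇
    -- The test includes `x` itself, so that separators belong to no block.
    ∀̇ (suc (π zero) ≺ zero ∧̇ (zero ≺ suc x ∨̇ zero ≐ suc x) ⇒̇ C zero zero ⇒̇ ⊥̇)

  block-col : ∀ {k} → Fin e → (Fin 1 → Fin k) → Fin k → Formula (suc e) k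
  block-col i _ x = C (suc i) x

  open Translation block-dom block-col

  typed : ∀ {k} → Sentence e → Fin k → Formula (suc e) k
  typed τ x = C zero x ∧̇ translate (λ _ → x) (λ ()) τ

  limit : Sentence e → Sentence e → Sentence (suc e)
  limit τ τ′ = ∀̇ ∀̇ (zero ≺ suc zero ∧̇ typed τ′ (suc zero) ⇒̇
    ∃̇ (suc zero ≺ zero ∧̇ zero ≺ suc (suc zero) ∧̇ typed τ zero))

  cofinal : Sentence e → Sentence (suc e)
  cofinal τ = ∀̇ ∃̇ (suc zero ≺ zero ∧̇ typed τ zero)

  ladder : ∀ m → (Fin (suc m) → Sentence e) → Sentence (suc e)
  -- The first conjunct rules out the empty order, which satisfies the others vacuously.
  ladder m τ = ∃̇ (⊥̇ ⇒̇ ⊥̇) ∧̇ cofinal (τ (fromℕ m)) ∧̇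
    ⋀ m (λ k → limit (τ (inject₁ k)) (τ (suc k)))

  qr-typed : ∀ {k r} τ (x : Fin k) → qr τ ≤ r → qr (typed τ x) ≤ r + 1
  qr-typed τ x qr≤r = ℕ.≤-trans
    (qr-translate 1 (λ _ _ → ℕ.≤-refl) (λ _ _ _ → z≤n) (λ _ → x) (λ ()) τ)
    (ℕ.+-monoˡ-≤ 1 qr≤r)

  qr-ladder : ∀ {r} m (τ : Fin (suc m) → Sentence e) → (∀ i → qr (τ i) ≤ r) →
    qr (ladder m τ) ≤ 3 + (r + 1)
  qr-ladder m τ qr≤r = ℕ.⊔-lub (s≤s z≤n) (ℕ.⊔-lub
    (s≤s (s≤s (ℕ.m≤n⇒m≤1+n (qr-typed (τ (fromℕ m)) zero (qr≤r (fromℕ m))))))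
    (qr-⋀ m _ λ k → s≤s (s≤s (ℕ.⊔-lub (ℕ.m≤n⇒m≤1+n (qr-typed (τ (suc k)) (suc zero) (qr≤r (suc k))))
      (s≤s (qr-typed (τ (inject₁ k)) zero (qr≤r (inject₁ k))))))))

  module _ (𝔅 : ColoredOrdinal (suc e)) where
    open ColoredOrdinal 𝔅

    InBlock : Rel Carrier 0ℓ
    InBlock z y = z < y × (∀ s → z < s × (s < y ⊎ s ≡ y) → ¬ color s ≡ zero)

    module _ {𝔄 : ColoredOrdinal e} {z : Carrier} (h : ColoredOrdinal.otp 𝔄 ↪ otp)
      (h-block : ∀ y → InBlock z y ⇔ (∃[ a ] _↪_.to h a ≡ y))
      (h-color : ∀ a → color (_↪_.to h a) ≡ suc (ColoredOrdinal.color 𝔄 a)) where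
      open _↪_ h renaming (to to h₀)

      block-realizes : Realizes 𝔄 𝔅 (λ _ → z) h₀
      block-realizes = record
        { h-mono   = mono
        ; dom-spec = λ {k} {ρ} {π} x ρπ →
            subst (λ z → InBlock z (lookup ρ x) ⇔ (∃[ a ] h₀ a ≡ lookup ρ x))
              (sym (ρπ zero)) (h-block _)
        ; col-spec = λ i x a _ x≡ha → mk⇔
            (λ s → Fin.suc-injective (trans (sym (h-color a)) (trans (cong color (sym x≡ha)) s)))
            (λ s → trans (cong color x≡ha) (trans (h-color a) (cong suc s)))
        }

      -- The block is presented by an arbitrary `h`, because it is a suborder in a given model but a
      -- copy of a prescribed ordinal in the constructed one.
      typed-spec : ∀ {k} {ρ : Vec Carrier k} τ x → lookup ρ x ≡ z →
        ⟦ 𝔅 ⟧ (typed τ x) ρ ⇔ (color z ≡ zero × 𝔄 ⊨ τ)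
      typed-spec τ x refl =
        let spec = translate-spec block-realizes {ρ = []} {π = λ _ → x} {σ = λ ()}
                     τ (λ _ → refl) (λ ()) in
        mk⇔ (Product.map id (from spec)) (Product.map id (to spec))

module LadderModels (em : ExcludedMiddle (Level.suc 0ℓ)) (e : ℕ) where
  open Ladder (suc e)
  open Classical em

  private
    unseparate : Fin (suc (suc e)) → Fin (suc e)
    -- A dummy value: blocks contain no point of color `zero`.
    unseparate zero    = zero
    unseparate (suc i) = i

    suc-unseparate : ∀ {i : Fin (suc (suc e))} → ¬ i ≡ zero → i ≡ suc (unseparate i)
    suc-unseparate {zero}  i≢0 = contradiction refl i≢0
    suc-unseparate {suc i} i≢0 = refl

  module _ (𝔅 : ColoredOrdinal (suc (suc e))) where
    open ColoredOrdinal 𝔅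

    block : Carrier → ColoredOrdinal (suc e)
    block z = restrict 𝔅 (InBlock 𝔅 z) (unseparate ∘ color)

    block-spec : ∀ {k} {ρ : Vec Carrier k} τ x →
      ⟦ 𝔅 ⟧ (typed τ x) ρ ⇔ (color (lookup ρ x) ≡ zero × block (lookup ρ x) ⊨ τ)
    block-spec {ρ = ρ} τ x = typed-spec 𝔅 {block z} (sub-↪ otp (InBlock 𝔅 z))
      (λ y → mk⇔ (λ in-block → (y ,ʳ [ in-block ]) , refl) (λ { (y , refl) → proof y }))
      (λ y → let (z<y , no-sep) = proof y in
        suc-unseparate (no-sep (value y) (z<y , inj₂ refl)))
      τ x refl
      where z = lookup ρ x

    ladder-↪ : ∀ m τ → 𝔅 ⊨ ladder m τ → ω^ suc m ↪ otp
    ladder-↪ m τ ((y , _) , cofinal , limits) = power-embeds P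
      (λ k y<z Pz →
        let (w , y<w , w<z , Pw) = to (⋀-spec m _) limits k _ _
              (y<z , from (block-spec (τ (suc k)) (suc zero)) Pz)
        in w , y<w , w<z , to (block-spec (τ (inject₁ k)) zero) Pw)
      (λ y → let (z , y<z , Pz) = cofinal y in z , y<z , to (block-spec (τ (fromℕ m)) zero) Pz)
      y
      where
      open Climbing otp
      P : Fin (suc m) → Carrier → Set
      P k z = color z ≡ zero × block z ⊨ τ k

-- Ordered sums.

module _ (I : WellOrder) (J : WellOrder.Carrier I → WellOrder) where
  private
    module I = WO I
    module J i = WO (J i)

  infix 4 _<Σ_
  data _<Σ_ : Rel (Σ I.Carrier J.Carrier) 0ℓ where
    outer : ∀ {i j x y} → i I.< j → (i , x) <Σ (j , y)
    inner : ∀ {i x y} → J._<_ i x y → (i , x) <Σ (i , y)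

  Σᵒ : WellOrder
  Σᵒ = record
    { Carrier            = Σ I.Carrier J.Carrier
    ; _<_                = _<Σ_
    ; isStrictTotalOrder = strictTotalOrder wf <Σ-trans connex
    ; wellFounded        = wf
    }
    where
    accessible : ∀ {i x} → Acc I._<_ i → Acc (J._<_ i) x → Acc _<Σ_ (i , x)
    accessible-below : ∀ {i x} → Acc I._<_ i → Acc (J._<_ i) x → WfRec _<Σ_ (Acc _<Σ_) (i , x)
    accessible accI accJ = acc (accessible-below accI accJ)
    accessible-below (acc rsI) _         (outer i<j) = accessible (rsI i<j) (J.wellFounded _ _)
    accessible-below accI      (acc rsJ) (inner x<y) = accessible accI (rsJ x<y)

    wf : WellFounded _<Σ_
    wf (i , x) = accessible (I.wellFounded i) (J.wellFounded i x)

    <Σ-trans : ∀ {p q r} → p <Σ q → q <Σ r → p <Σ r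
    <Σ-trans (outer i<j) (outer j<k) = outer (I.<-trans i<j j<k)
    <Σ-trans (outer i<j) (inner _)   = outer i<j
    <Σ-trans (inner _)   (outer j<k) = outer j<k
    <Σ-trans (inner x<y) (inner y<z) = inner (J.<-trans _ x<y y<z)

    connex : ∀ p q → p <Σ q ⊎ p ≡ q ⊎ q <Σ p
    connex (i , x) (j , y) with I.compare i j
    ... | tri< i<j _ _ = inj₁ (outer i<j)
    ... | tri> _ _ j<i = inj₂ (inj₂ (outer j<i))
    ... | tri≈ _ refl _ with J.compare i x y
    ...   | tri< x<y _ _  = inj₁ (inner x<y)
    ...   | tri≈ _ refl _ = inj₂ (inj₁ refl)
    ...   | tri> _ _ y<x  = inj₂ (inj₂ (inner y<x))

1+ᵒ : WellOrder → WellOrder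
1+ᵒ α = record
  { Carrier            = Carrier ₋
  ; _<_                = _<₋_ _<_
  ; isStrictTotalOrder = <₋-isStrictTotalOrder-≡ _<_ isStrictTotalOrder
  ; wellFounded        = <₋-wellFounded _<_ wellFounded
  }
  where
  open WO α

-- Least exponents of ordinals below a power of `ω`.

⊥ω : ∀ n → WellOrder.Carrier (ω^ n)
⊥ω zero    = zero
⊥ω (suc n) = 0 , ⊥ω n

⊥ω-least : ∀ n a → WellOrder._<_ (ω^ n) (⊥ω n) a ⊎ ⊥ω n ≡ a
⊥ω-least zero    zero          = inj₂ refl
⊥ω-least (suc n) (suc i , a)   = inj₁ (inj₁ ℕ.z<s)
⊥ω-least (suc n) (zero , a)    = Sum.map (λ ⊥<a → inj₂ (refl , ⊥<a)) (cong (0 ,_)) (⊥ω-least n a)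

private
  -- The pair `(i , a)` in `ω^ suc n` is the ordinal ω^n · i + a. Its least exponent is that of `a`,
  -- or `n` if `a` is 0 and `i` is not.
  carry : ∀ {n} → ℕ → Maybe (Fin n) → Maybe (Fin (suc n))
  carry i       (just k) = just (inject₁ k)
  carry zero    nothing  = nothing
  carry (suc i) nothing  = just (fromℕ _)

-- The least exponent in the Cantor normal form, undefined for 0.
val : ∀ n → WellOrder.Carrier (ω^ n) → Maybe (Fin n)
val zero    _       = nothing
val (suc n) (i , a) = carry i (val n a)

val-⊥ω : ∀ n → val n (⊥ω n) ≡ nothing
val-⊥ω zero    = refl
val-⊥ω (suc n) = cong (carry 0) (val-⊥ω n)

val-nothing : ∀ n a → val n a ≡ nothing → a ≡ ⊥ω n
val-nothing zero    zero       _  = refl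
val-nothing (suc n) (i , a)    eq with val n a in val-a
val-nothing (suc n) (zero , a) eq | nothing = cong (0 ,_) (val-nothing n a val-a)

-- The witness is ω^n · (i + 1), the bottom of the next copy of ω^n.
val-cofinal : ∀ n b → ∃[ c ] WellOrder._<_ (ω^ suc n) b c × val (suc n) c ≡ just (fromℕ n)
val-cofinal n (i , b) = (suc i , ⊥ω n) , inj₁ (ℕ.n<1+n i) , cong (carry (suc i)) (val-⊥ω n)

-- Write the point as ω^n · i + a. For nonzero `a` the search goes on below `a` within the copy
-- numbered `i`; otherwise the exponent is `n` and the preceding copy is used. Exponents are
-- compared by `toℕ`, since the recursion changes their bound.
val-limit : ∀ n {k j a b} → val n a ≡ just j → toℕ j ≡ suc k → WellOrder._<_ (ω^ n) b a →
  ∃[ c ] ∃[ j′ ] WellOrder._<_ (ω^ n) b c × WellOrder._<_ (ω^ n) c a ×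
    val n c ≡ just j′ × toℕ j′ ≡ k
val-limit (suc n) {k} {a = i , a} {i′ , b} eq j≡ b<a with val n a in val-a
val-limit (suc n) {k} {a = i , a} {i′ , b} refl j≡ b<a | just j₀ = below b<a
  where
  j₀≡ = trans (sym (Fin.toℕ-inject₁ j₀)) j≡
  within : ∀ {b} → WellOrder._<_ (ω^ n) b a →
    ∃[ c ] ∃[ j′ ] WellOrder._<_ (ω^ n) b c × WellOrder._<_ (ω^ n) c a ×
      val (suc n) (i , c) ≡ just j′ × toℕ j′ ≡ k
  within b<a = let (c , j′ , b<c , c<a , val-c , j′≡) = val-limit n val-a j₀≡ b<a in
    c , inject₁ j′ , b<c , c<a , cong (carry i) val-c , trans (Fin.toℕ-inject₁ j′) j′≡
  ⊥<a : WellOrder._<_ (ω^ n) (⊥ω n) a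
  ⊥<a with ⊥ω-least n a
  ... | inj₁ ⊥<a  = ⊥<a
  ... | inj₂ refl with () ← trans (sym (val-⊥ω n)) val-a
  below : WellOrder._<_ (ω^ suc n) (i′ , b) (i , a) → _
  -- When `b` lies in an earlier copy, the search starts at the bottom of this one, which is below
  -- `a` because `val n a` is defined.
  below (inj₁ i′<i) = let (c , j′ , _ , c<a , rest) = within ⊥<a in
    (i , c) , j′ , inj₁ i′<i , inj₂ (refl , c<a) , rest
  below (inj₂ (refl , b<a)) = let (c , j′ , b<c , c<a , rest) = within b<a in
    (i , c) , j′ , inj₂ (refl , b<c) , inj₂ (refl , c<a) , rest
val-limit (suc n) {k} {a = suc i , a} {i′ , b} refl j≡ b<a | nothing
  -- The exponent `n` is k + 1, so each copy is an ω^(k + 1), in which exponent k is cofinal. The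
  -- `c` found above `b` serves also when `b` lies in an earlier copy.
  with refl ← trans (sym (Fin.toℕ-fromℕ n)) j≡
  with val-cofinal k b
... | c , b<c , val-c = (i , c) , inject₁ (fromℕ k) , above b<a , inj₁ (ℕ.n<1+n i) ,
  cong (carry i) val-c , trans (Fin.toℕ-inject₁ (fromℕ k)) (Fin.toℕ-fromℕ k)
  where
  above : WellOrder._<_ (ω^ suc n) (i′ , b) (suc i , a) → WellOrder._<_ (ω^ suc n) (i′ , b) (i , c)
  above (inj₁ i′<1+i) with ℕ.m≤n⇒m<n∨m≡n (ℕ.s≤s⁻¹ i′<1+i)
  ... | inj₁ i′<i = inj₁ i′<i
  ... | inj₂ refl = inj₂ (refl , b<c)
  above (inj₂ (refl , b<a)) with refl ← val-nothing n a val-a | ⊥ω-least n b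
  ... | inj₁ ⊥<b  = contradiction (WO.<-trans (ω^ n) ⊥<b b<a) (WO.irrefl (ω^ n))
  ... | inj₂ refl = contradiction b<a (WO.irrefl (ω^ n))

-- A model of the ladder on ω^(m + 1).

module LadderModel (e : ℕ) (m : ℕ) (𝔄 : Fin (suc m) → ColoredOrdinal e)
  (τ : Fin (suc m) → Sentence e) (distinct : ∀ {j k} → 𝔄 j ⊨ τ k ⇔ j ≡ k) where
  open Ladder e
  private
    module 𝔄 k = ColoredOrdinal (𝔄 k)
    module Ω = WellOrder (ω^ suc m)

  -- The default concerns only the ordinal 0: it gets type `zero`, on which `ladder` imposes no
  -- limit condition.
  rank : Ω.Carrier → Fin (suc m)
  rank α = fromMaybe zero (val (suc m) α)

  rank-suc : ∀ {α k} → rank α ≡ suc k → val (suc m) α ≡ just (suc k)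
  rank-suc {α} eq with val (suc m) α
  ... | just _ = cong just eq

  -- At α ∈ ω^(m + 1) stands a separator followed by a copy of 𝔄 (rank α).
  model : ColoredOrdinal (suc e)
  model = record
    { otp   = Σᵒ (ω^ suc m) (1+ᵒ ∘ 𝔄.otp ∘ rank)
    ; color = λ { (α , ⊥₋) → zero ; (α , [ a ]) → suc (𝔄.color (rank α) a) }
    }
  open ColoredOrdinal model

  -- Every point beyond the copy of `𝔄 (rank α)` has its own separator at or before it, so the block
  -- of `(α , ⊥₋)` is exactly this copy, and `distinct` identifies its type.
  typed-separator : ∀ {k n} {ρ : Vec Carrier n} x {α} → lookup ρ x ≡ (α , ⊥₋) →
    ⟦ model ⟧ (typed (τ k) x) ρ ⇔ rank α ≡ k
  typed-separator {k} x {α} x≡ = ⇔-trans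
    (typed-spec model {𝔄 (rank α)} (mk↪ (λ a → α , [ a ]) (inner ∘ [_]))
      (λ y → mk⇔ (in-block y) λ { (a , refl) → inner ⊥₋<[ a ] , not-sep }) (λ _ → refl)
      (τ k) x x≡)
    (⇔-trans (mk⇔ proj₂ (refl ,_)) distinct)
    where
    in-block : ∀ y → InBlock model (α , ⊥₋) y → ∃[ a ] (α , [ a ]) ≡ y
    in-block (β , [ b ]) (inner _ , _)         = b , refl
    in-block (β , ⊥₋)    (outer α<β , no-sep)  =
      contradiction refl (no-sep (β , ⊥₋) (outer α<β , inj₂ refl))
    in-block (β , [ b ]) (outer α<β , no-sep)  =
      contradiction refl (no-sep (β , ⊥₋) (outer α<β , inj₁ (inner ⊥₋<[ b ])))
    not-sep : ∀ {a} s → (α , ⊥₋) < s × (s < (α , [ a ]) ⊎ s ≡ (α , [ a ])) → ¬ color s ≡ zero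
    not-sep (_ , [ _ ]) _ ()
    not-sep (_ , ⊥₋) (outer α<β , inj₁ (outer β<α)) =
      contradiction (WO.<-trans (ω^ suc m) α<β β<α) (WO.irrefl (ω^ suc m))
    not-sep (_ , ⊥₋) (outer α<α , inj₁ (inner _))   = contradiction α<α (WO.irrefl (ω^ suc m))
    not-sep (_ , ⊥₋) (inner () , _)

  model-⊨-ladder : model ⊨ ladder m τ
  model-⊨-ladder = ((⊥ω (suc m) , ⊥₋) , id) , cofinal-spec , from (⋀-spec m _) limit-spec
    where
    cofinal-spec : model ⊨ cofinal (τ (fromℕ m))
    cofinal-spec (α , _) = let (β , α<β , val-β) = val-cofinal m α in
      (β , ⊥₋) , outer α<β , from (typed-separator zero refl) (cong (fromMaybe zero) val-β)

    limit-spec : ∀ k → model ⊨ limit (τ (inject₁ k)) (τ (suc k))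
    -- Only the outer coordinate of the lower point matters: a separator at `β` above `α` lies
    -- beyond the whole summand at `α`.
    limit-spec k (γ , ⊥₋)    (α , _) (outer α<γ , typed-γ) =
      let (β , j , α<β , β<γ , val-β , j≡k) = val-limit (suc m)
            (rank-suc (to (typed-separator (suc zero) refl) typed-γ)) refl α<γ
      in (β , ⊥₋) , outer α<β , outer β<γ , from (typed-separator zero refl)
           (trans (cong (fromMaybe zero) val-β)
             (Fin.toℕ-injective (trans j≡k (sym (Fin.toℕ-inject₁ k)))))
    limit-spec k (γ , ⊥₋)    (α , _) (inner () , _)
    limit-spec k (γ , [ _ ]) (α , _) (_ , () , _)

-- Coding three colors by two.

-- A point of color c ∈ {0, 1, 2} is coded by a point of color 0 followed by c points of
-- color 1; thus the padding of a start is its block in the sense of Ladder.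
module Coding (d : ℕ) where
  open Ladder (suc d) using (block-dom; InBlock)

  -- Since `block-dom` has rank 1, the ranks are 2 and 3; the larger one is the cost of the coding.
  padded₁ padded₂ : ∀ {k} → Fin k → Formula (2 + d) k
  padded₁ x = ∃̇ block-dom (λ _ → suc x) zero
  padded₂ x = ∃̇ ∃̇ (suc zero ≺ zero ∧̇ block-dom (λ _ → suc (suc x)) (suc zero) ∧̇
    block-dom (λ _ → suc (suc x)) zero)

  start : ∀ {k} → (Fin 0 → Fin k) → Fin k → Formula (2 + d) k
  start _ x = C zero x

  code : ∀ {k} → Fin 3 → (Fin 0 → Fin k) → Fin k → Formula (2 + d) k
  code zero             _ x = padded₁ x ⇒̇ ⊥̇
  code (suc zero)       _ x = padded₁ x ∧̇ (padded₂ x ⇒̇ ⊥̇)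
  code (suc (suc zero)) _ x = padded₂ x

  qr-code : ∀ {k} i (π : Fin 0 → Fin k) x → qr (code i π x) ≤ 3
  qr-code zero             _ _ = ℕ.n≤1+n 2
  qr-code (suc zero)       _ _ = ℕ.≤-refl
  qr-code (suc (suc zero)) _ _ = ℕ.≤-refl

  open Translation start code

  encode : Sentence 3 → Sentence (2 + d)
  encode = translate (λ ()) (λ ())

  qr-encode : ∀ φ → qr (encode φ) ≤ qr φ + 3
  qr-encode = qr-translate 3 (λ _ _ → z≤n) qr-code (λ ()) (λ ())

  module _ (𝔅 : ColoredOrdinal (2 + d)) where
    open ColoredOrdinal 𝔅

    Padded₁ Padded₂ : Carrier → Set
    Padded₁ x = ∃[ y ] InBlock 𝔅 x y
    Padded₂ x = ∃[ y ] ∃[ z ] y < z × InBlock 𝔅 x y × InBlock 𝔅 x z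

    CodedBy : Carrier → Fin 3 → Set
    CodedBy x c = (Padded₁ x ⇔ 1 ≤ toℕ c) × (Padded₂ x ⇔ 2 ≤ toℕ c)

    code-spec : ∀ {k} {ρ : Vec Carrier k} {π} x {c} → CodedBy (lookup ρ x) c → ∀ i →
      ⟦ 𝔅 ⟧ (code i π x) ρ ⇔ c ≡ i
    code-spec x {zero} (p₁ , p₂) zero =
      mk⇔ (λ _ → refl) (λ _ p → case to p₁ p of λ ())
    code-spec x {zero} (p₁ , p₂) (suc zero) =
      mk⇔ (λ (p , _) → case to p₁ p of λ ()) λ ()
    code-spec x {zero} (p₁ , p₂) (suc (suc zero)) =
      mk⇔ (λ p → case to p₂ p of λ ()) λ ()
    code-spec x {suc zero} (p₁ , p₂) zero =
      mk⇔ (λ ¬p → contradiction (from p₁ ℕ.≤-refl) ¬p) λ ()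
    code-spec x {suc zero} (p₁ , p₂) (suc zero) =
      mk⇔ (λ _ → refl) (λ _ → from p₁ ℕ.≤-refl , λ p → case to p₂ p of λ { (s≤s ()) })
    code-spec x {suc zero} (p₁ , p₂) (suc (suc zero)) =
      mk⇔ (λ p → case to p₂ p of λ { (s≤s ()) }) λ ()
    code-spec x {suc (suc zero)} (p₁ , p₂) zero =
      mk⇔ (λ ¬p → contradiction (from p₁ (s≤s z≤n)) ¬p) λ ()
    code-spec x {suc (suc zero)} (p₁ , p₂) (suc zero) =
      mk⇔ (λ (_ , ¬p) → contradiction (from p₂ ℕ.≤-refl) ¬p) λ ()
    code-spec x {suc (suc zero)} (p₁ , p₂) (suc (suc zero)) =
      mk⇔ (λ _ → refl) (λ _ → from p₂ ℕ.≤-refl)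

    encode-spec : ∀ {𝔄 : ColoredOrdinal 3} (h : ColoredOrdinal.otp 𝔄 ↪ otp)
      (let open _↪_ h renaming (to to h₀)) →
      (∀ x → color x ≡ zero ⇔ (∃[ a ] h₀ a ≡ x)) →
      (∀ a → CodedBy (h₀ a) (ColoredOrdinal.color 𝔄 a)) →
      ∀ φ → 𝔄 ⊨ φ ⇔ 𝔅 ⊨ encode φ
    encode-spec {𝔄} h h-start h-code φ = translate-spec realizes φ (λ ()) (λ ())
      where
      open _↪_ h renaming (to to h₀)
      realizes : Realizes 𝔄 𝔅 (λ ()) h₀
      realizes = record
        { h-mono   = mono
        ; dom-spec = λ x _ → h-start _
        ; col-spec = λ {_} {_} {π} i x a _ x≡ →
            code-spec {π = π} x (subst (λ y → CodedBy y _) (sym x≡) (h-code a)) i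
        }

  module Encoded (𝔄 : ColoredOrdinal 3) where
    private
      module 𝔄 = ColoredOrdinal 𝔄

    model : ColoredOrdinal (2 + d)
    model = record
      { otp   = Σᵒ 𝔄.otp (fin ∘ suc ∘ toℕ ∘ 𝔄.color)
      ; color = λ { (_ , zero) → zero ; (_ , suc _) → suc zero }
      }
    open ColoredOrdinal model

    in-padding : ∀ {a x} → InBlock model (a , zero) x → ∃[ j ] x ≡ (a , suc j)
    in-padding {x = _ , suc j} (inner _ , _) = j , refl
    in-padding {x = b , zero}  (outer a<b , no-start) =
      contradiction refl (no-start (b , zero) (outer a<b , inj₂ refl))
    in-padding {x = b , suc _} (outer a<b , no-start) =
      contradiction refl (no-start (b , zero) (outer a<b , inj₁ (inner ℕ.z<s)))

    padding-in : ∀ {a} j → InBlock model (a , zero) (a , suc j)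
    padding-in {a} j = inner ℕ.z<s , no-start
      where
      no-start : ∀ s → (a , zero) < s × (s < (a , suc j) ⊎ s ≡ (a , suc j)) → ¬ color s ≡ zero
      no-start (_ , suc _) _ ()
      no-start (_ , zero) (outer a<b , inj₁ (outer b<a)) =
        contradiction (WO.<-trans 𝔄.otp a<b b<a) (WO.irrefl 𝔄.otp)
      no-start (_ , zero) (outer a<a , inj₁ (inner _))   = contradiction a<a (WO.irrefl 𝔄.otp)
      no-start (_ , zero) (inner () , _)

    coded : ∀ a → CodedBy model (a , zero) (𝔄.color a)
    coded a = mk⇔ one (λ 1≤c → _ , padding-in (Fin.fromℕ< 1≤c)) , mk⇔ two two′
      where
      one : Padded₁ model (a , zero) → 1 ≤ toℕ (𝔄.color a)
      one (_ , in-block) = let (j , _) = in-padding in-block in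
        ℕ.≤-trans (s≤s z≤n) (Fin.toℕ<n j)
      two : Padded₂ model (a , zero) → 2 ≤ toℕ (𝔄.color a)
      two (_ , _ , y<z , in-y , in-z) with in-padding in-y | in-padding in-z
      two (_ , _ , inner j<k , _) | j , refl | k , refl =
        ℕ.≤-trans (s≤s (ℕ.≤-trans (s≤s z≤n) (ℕ.s<s⁻¹ j<k))) (Fin.toℕ<n k)
      two (_ , _ , outer a<a , _) | j , refl | k , refl = contradiction a<a (WO.irrefl 𝔄.otp)
      two′ : 2 ≤ toℕ (𝔄.color a) → Padded₂ model (a , zero)
      two′ 2≤c = _ , _ ,
        inner (ℕ.s<s (subst₂ ℕ._<_ (sym (Fin.toℕ-fromℕ< 1≤c)) (sym (Fin.toℕ-fromℕ< 2≤c)) ℕ.z<s)) ,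
        padding-in (Fin.fromℕ< 1≤c) , padding-in (Fin.fromℕ< 2≤c)
        where
        1≤c = ℕ.≤-trans (ℕ.n≤1+n 1) 2≤c

    model-⊨ : ∀ φ → 𝔄 ⊨ φ → model ⊨ encode φ
    model-⊨ φ = to (encode-spec model {𝔄} (mk↪ (_, zero) outer)
      (λ { (a , zero)  → mk⇔ (λ _ → a , refl) (λ _ → refl)
         ; (a , suc _) → mk⇔ (λ ()) λ () })
      coded φ)

  module Decoded (em : ExcludedMiddle (Level.suc 0ℓ)) (𝔅 : ColoredOrdinal (2 + d)) where
    open ColoredOrdinal 𝔅
    open Classical em

    -- The padding is counted only up to two, so a longer one also codes the last color; hence every
    -- model of `encode φ` can be decoded.
    codes : ∀ x → ∃[ c ] CodedBy 𝔅 x c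
    codes x with decide (Padded₁ 𝔅 x) | decide (Padded₂ 𝔅 x)
    ... | yes p₁ | yes p₂ = suc (suc zero) ,
      mk⇔ (λ _ → s≤s z≤n) (λ _ → p₁) , mk⇔ (λ _ → ℕ.≤-refl) (λ _ → p₂)
    ... | yes p₁ | no ¬p₂ = suc zero ,
      mk⇔ (λ _ → ℕ.≤-refl) (λ _ → p₁) , mk⇔ (λ p₂ → contradiction p₂ ¬p₂) λ { (s≤s ()) }
    ... | no ¬p₁ | no ¬p₂ = zero ,
      mk⇔ (λ p₁ → contradiction p₁ ¬p₁) (λ ()) , mk⇔ (λ p₂ → contradiction p₂ ¬p₂) (λ ())
    ... | no ¬p₁ | yes (y , _ , _ , in-y , _) = contradiction (y , in-y) ¬p₁

    model : ColoredOrdinal 3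
    model = restrict 𝔅 (λ x → color x ≡ zero) (proj₁ ∘ codes)

    model-⊨ : ∀ φ → 𝔅 ⊨ encode φ → model ⊨ φ
    model-⊨ φ = from (encode-spec 𝔅 {model} (sub-↪ otp _)
      (λ x → mk⇔ (λ x-start → (x ,ʳ [ x-start ]) , refl)
                 λ { (a , refl) → proof {P = λ x → color x ≡ zero} a })
      (λ a → proj₂ (codes (value a))) φ)

-- From forced embeddings to the estimates.

Forces : ∀ {d} → Sentence d → WellOrder → Set₁
Forces φ α = (∃[ 𝔄 ] 𝔄 ⊨ φ) × (∀ 𝔅 → 𝔅 ⊨ φ → α ↪ ColoredOrdinal.otp 𝔅)

module _ (em : ExcludedMiddle (Level.suc 0ℓ)) where
  open Classical em

  ladder-forces : ∀ {e r} (T : CharacteristicSet (suc e) r) →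
    Σ (Sentence (2 + e)) λ φ → qr φ ≤ 3 + (r + 1) × Forces φ (ω^ ∣ T ∣)
  ladder-forces record { size = zero ; complete = complete }
    -- The empty ordinal has a characteristic sentence, so the list is not empty.
    with () ← proj₁ (complete record { otp = fin 0 ; color = λ () })
  ladder-forces {e} {r}
    record { size = suc m ; sentence = τ ; sound = sound ; complete = complete } =
    ladder m τ , qr-ladder m τ (λ k → proj₁ (proj₂ (sound k))) ,
    (model , model-⊨-ladder) , λ 𝔅 → LadderModels.ladder-↪ em e 𝔅 m τ
    where
    open Ladder (suc e)
    ≡-sym : ∀ {𝔄 𝔅 : ColoredOrdinal (suc e)} → 𝔄 ≡[ r ] 𝔅 → 𝔅 ≡[ r ] 𝔄
    ≡-sym 𝔄≡𝔅 φ qr≤ = ⇔-sym (𝔄≡𝔅 φ qr≤)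
    ≡-trans : ∀ {𝔄 𝔅 ℭ : ColoredOrdinal (suc e)} → 𝔄 ≡[ r ] 𝔅 → 𝔅 ≡[ r ] ℭ → 𝔄 ≡[ r ] ℭ
    ≡-trans 𝔄≡𝔅 𝔅≡ℭ φ qr≤ = ⇔-trans (𝔄≡𝔅 φ qr≤) (𝔅≡ℭ φ qr≤)
    𝔄 : Fin (suc m) → ColoredOrdinal (suc e)
    𝔄 = proj₁ ∘ sound
    distinct : ∀ {j k} → 𝔄 j ⊨ τ k ⇔ j ≡ k
    distinct {j} {k} = mk⇔ unique λ { refl → from (τ-char j (𝔄 j)) (λ _ _ → ⇔-refl) }
      where
      τ-char : ∀ k 𝔅 → 𝔅 ⊨ τ k ⇔ 𝔅 ≡[ r ] 𝔄 k
      τ-char k = proj₂ (proj₂ (sound k))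
      -- If `𝔄 j` satisfies `τ k`, then `τ k` is characteristic for `𝔄 j` too, and `complete` allows
      -- only one such index.
      unique : 𝔄 j ⊨ τ k → j ≡ k
      unique 𝔄ⱼ⊨τₖ =
        let (_ , _ , only) = complete (𝔄 j)
            𝔄ⱼ≡𝔄ₖ = to (τ-char k (𝔄 j)) 𝔄ⱼ⊨τₖ
        in trans (sym (only j (proj₂ (sound j)))) (only k
             (proj₁ (proj₂ (sound k)) , λ 𝔅 → ⇔-trans (τ-char k 𝔅)
               (mk⇔ (λ p → ≡-trans {𝔅} {𝔄 k} {𝔄 j} p (≡-sym {𝔄 j} {𝔄 k} 𝔄ⱼ≡𝔄ₖ))
                    (λ p → ≡-trans {𝔅} {𝔄 j} {𝔄 k} p 𝔄ⱼ≡𝔄ₖ))))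
    open LadderModel (suc e) m 𝔄 τ distinct

  -- The decoded model is a suborder of `𝔅`, in general not an initial segment; this is why `Forces`
  -- speaks of embeddings, which compose with the inclusion.
  encode-forces : ∀ {d α} φ → Forces φ α → Forces (Coding.encode d φ) α
  encode-forces {d} φ ((𝔄 , 𝔄⊨φ) , force) = (Encoded.model 𝔄 , Encoded.model-⊨ 𝔄 φ 𝔄⊨φ) ,
    λ 𝔅 𝔅⊨φ → ↪-trans (force (Decoded.model em 𝔅) (Decoded.model-⊨ em 𝔅 φ 𝔅⊨φ)) (sub-↪ _ _)
    where open Coding d

  -- Let σ be the characteristic sentence of the model `𝔄` of `φ`. As `qr φ ≤ q`, all models of σ
  -- agree with `𝔄` on `φ`, so `α` embeds into the least of them, whose order type is at most `g`.
  forced-≤-g : ∀ {d q α} (S : CharacteristicSet d q) φ → qr φ ≤ q → Forces φ α →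
    ∀ g → IsGOrd S g → α ≤ᵒ g
  forced-≤-g {d} {q} S φ qr≤q ((𝔄 , 𝔄⊨φ) , force) g (_ , g-max) with CharacteristicSet.complete S 𝔄
  ... | i , (_ , σ-char) , _
    with minimum (ModelOrderType (CharacteristicSet.sentence S i))
           (λ {α} {β} α≅β (𝔅 , 𝔅⊨σ , 𝔅≅α) →
             𝔅 , 𝔅⊨σ , ≅ᵒ-trans {ColoredOrdinal.otp 𝔅} {α} {β} 𝔅≅α α≅β)
           (ColoredOrdinal.otp 𝔄 , 𝔄 , from (σ-char 𝔄) (λ _ _ → ⇔-refl) ,
             ≅ᵒ-refl {ColoredOrdinal.otp 𝔄})
  ...   | μ , μ-min@((𝔅 , 𝔅⊨σ , 𝔅≅μ) , _) = ↪⇒≤ᵒ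
          (↪-trans (force 𝔅 (from (to (σ-char 𝔅) 𝔅⊨σ φ qr≤q) 𝔄⊨φ))
          (↪-trans (≅ᵒ⇒↪ 𝔅≅μ) (≤ᵒ⇒↪ {μ} {g} (g-max μ (i , μ-min)))))

theorem8 : ExcludedMiddle (Level.suc 0ℓ) →
    ((d q : ℕ) → 2 ≤ d → 5 ≤ q →
    (S : CharacteristicSet d q) (T : CharacteristicSet (d ∸ 1) (q ∸ 4)) →
    (g : WellOrder) → IsGOrd S g → ω^ ∣ T ∣ ≤ᵒ g)
    ×
    ((d q : ℕ) → 2 ≤ d → 8 ≤ q →
    (S : CharacteristicSet d q) (T : CharacteristicSet 2 (q ∸ 7)) →
    (g : WellOrder) → IsGOrd S g → ω^ ∣ T ∣ ≤ᵒ g)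
theorem8 em =
  (λ { (suc (suc d)) q (s≤s (s≤s _)) 5≤q S T →
       let (φ , qr≤ , forces) = ladder-forces em T in
       forced-≤-g em S φ (ℕ.≤-trans qr≤ (ℕ.≤-reflexive (bound₁ q 5≤q))) forces }) ,
  (λ { (suc (suc d)) q (s≤s (s≤s _)) 8≤q S T →
       let (φ , qr≤ , forces) = ladder-forces em T in
       -- The ladder over 2-colored blocks has three colors; coding them by two makes the sentence
       -- available for every number of colors from 2 on.
       forced-≤-g em S (Coding.encode d φ)
         (ℕ.≤-trans (Coding.qr-encode d φ)
           (ℕ.≤-trans (ℕ.+-monoˡ-≤ 3 qr≤) (ℕ.≤-reflexive (bound₂ q 8≤q))))
         (encode-forces em φ forces) })
  where
  open ≡-Reasoning
  bound₁ : ∀ q → 5 ≤ q → 3 + (q ∸ 4 + 1) ≡ q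
  bound₁ q 5≤q = begin
    3 + (q ∸ 4 + 1) ≡⟨ cong (3 +_) (ℕ.+-comm (q ∸ 4) 1) ⟩
    4 + (q ∸ 4)     ≡⟨ ℕ.m+[n∸m]≡n (ℕ.≤-trans (ℕ.n≤1+n 4) 5≤q) ⟩
    q               ∎
  bound₂ : ∀ q → 8 ≤ q → 3 + (q ∸ 7 + 1) + 3 ≡ q
  bound₂ q 8≤q = begin
    3 + (q ∸ 7 + 1) + 3 ≡⟨ cong (3 +_) (ℕ.+-assoc (q ∸ 7) 1 3) ⟩
    3 + (q ∸ 7 + 4)     ≡⟨ cong (3 +_) (ℕ.+-comm (q ∸ 7) 4) ⟩
    7 + (q ∸ 7)         ≡⟨ ℕ.m+[n∸m]≡n (ℕ.≤-trans (ℕ.n≤1+n 7) 8≤q) ⟩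
    q                   ∎
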